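{- Let $k\ge 2$, let $B=M\cup\{\omega_1,\ldots,\omega_p\}$ with $p\ge 1$ and $\omega_1,\ldots,\omega_p\in P_k\setminus M$, and let $F$ be a finite system of functions from $P_k(n)$. Then $$I_B(F)\ge\left\lceil \log_{d(B)+1}\bigl(d(F)+1\bigr)\right\rceil .$$
   Context: Let $k\ge 2$ be an integer and $E_k=\{0,1,\ldots,k-1\}$. $P_k(n)$ denotes the set of all functions $E_k^n\to E_k$, and $P_k=\bigcup_n P_k(n)$. Tuples in $E_k^n$ are ordered componentwise: $\tilde\alpha\le\tilde\beta$ iff $\alpha_j\le\beta_j$ for all $j$. A function $f$ is monotone if $\tilde\alpha\le\tilde\beta$ implies $f(\tilde\alpha)\le f(\tilde\beta)$; $M$ is the set of all monotone functions in $P_k$ (of all arities, including constants). A basis is a set $B=M\cup\{\omega_1,\ldots,\omega_p\}$ with $p\ge1$ and $\omega_i\in P_k\setminus M$. A circuit over $B$ with inputs $x_1,\ldots,x_n$ is a finite directed acyclic graph whose source nodes are labelled by the variables $x_1,\ldots,x_n$ and each of whose other nodes (gates) is labelled by a $q$-ary function from $B$ and has $q$ ordered incoming edges; each node computes a function of $P_k(n)$ in the obvious way. A circuit realizes a system $F$ of functions of $x_1,\ldots,x_n$ if every function of $F$ is computed at some node. Gates labelled by functions of $M$ have weight $0$, gates labelled by some $\omega_i$ have weight $1$. The non-monotone complexity $I_B(S)$ of a circuit $S$ is the sum of the weights of its gates; $I_B(F)$ is the minimum of $I_B(S)$ over all circuits $S$ over $B$ realizing $F$, and $I_B(f)=I_B(\{f\})$.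 A chain is a sequence $\tilde\alpha_1,\ldots,\tilde\alpha_r$ of pairwise distinct tuples of $E_k^n$ with $\tilde\alpha_i\le\tilde\alpha_{i+1}$ for $i=1,\ldots,r-1$. A pair $(\tilde\alpha,\tilde\beta)$ with $\tilde\alpha\le\tilde\beta$ is a jump for a system $F$ if $f(\tilde\alpha)>f(\tilde\beta)$ for at least one $f\in F$. For a chain $C=(\tilde\alpha_1,\ldots,\tilde\alpha_r)$, the decrease $d_C(F)$ is the number of $i\in\{1,\ldots,r-1\}$ such that $(\tilde\alpha_i,\tilde\alpha_{i+1})$ is a jump for $F$. The decrease $d(F)$ is the maximum of $d_C(F)$ over all chains $C$ in $E_k^n$; $d(f)=d(\{f\})$. Finally $d(B)=\max\{d(\omega_1),\ldots,d(\omega_p)\}$. -}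

module Defs where

open import Data.Fin.Base as Fin using (Fin)
import Data.Fin.Properties as Fin
import Data.Fin.Induction as Fin
open import Data.List.Base as List
  using (List; []; _∷_; length; lookup; filter; zip; drop; tabulate; allFin;
         cartesianProductWith)
open import Data.List.Extrema.Nat
  using (max; xs≤max; argmax; argmax-all; f[xs]≤f[argmax])
open import Data.List.Membership.Propositional using (_∈_)
open import Data.List.Membership.Propositional.Properties
  using (∈-allFin; ∈-lookup; ∈-cartesianProductWith⁺; ∈-filter⁺; ∈-tabulate⁺)
open import Data.List.Properties using (filter-accept)
open import Data.List.Relation.Unary.All as All using (All; []; _∷_)
import Data.List.Relation.Unary.All.Properties as All
open import Data.List.Relation.Unary.AllPairs using ([]; _∷_)
open import Data.List.Relation.Unary.Any as Any using (Any; here; there; any?)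
import Data.List.Relation.Unary.Any.Properties as Any
open import Data.List.Relation.Unary.Linked using (Linked; []; [-]; _∷_; linked?)
open import Data.List.Relation.Unary.Unique.Propositional using (Unique)
open import Data.Nat.Base
open import Data.Nat.ListAction using (sum)
open import Data.Nat.Properties
open import Data.Product.Base using (∃-syntax; _×_; _,_; proj₁; proj₂)
open import Data.Vec.Base as Vec using (Vec; []; _∷_)
import Data.Vec.Properties as Vec
open import Data.Vec.Relation.Binary.Pointwise.Inductive as Pointwise using (Pointwise)
open import Function.Base using (_∘_)
open import Induction.WellFounded using (Acc; acc; WellFounded)
open import Relation.Binary.Construct.Closure.Transitive
  using (TransClosure; transitive; wellFounded⁻)
import Relation.Binary.Definitions as Binary
open import Relation.Binary.PropositionalEquality
open import Relation.Nullary
open import Relation.Nullary.Decidable using (_×-dec_)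
open import Relation.Unary using (Decidable)
import Data.List.Relation.Unary.Unique.DecSetoid as DecUnique

IsMinimum : (ℕ → Set) → ℕ → Set
IsMinimum P m = P m × (∀ {i} → P i → m ≤ i)

IsMaximum : (ℕ → Set) → ℕ → Set
IsMaximum P m = P m × (∀ {i} → P i → i ≤ m)

-- For a ≥ 1 and b ≥ 2, ⌈log_b a⌉ is the least t with a ≤ b ^ t; it is at
-- most a, so the search started with fuel a succeeds.  For b ≤ 1 the value
-- has no meaning.

leastExponent : (b a fuel t : ℕ) → ℕ
leastExponent b a zero       t = t
leastExponent b a (suc fuel) t with a ≤? b ^ t
... | yes _ = t
... | no  _ = leastExponent b a fuel (suc t)

⌈log[_]_⌉ : ℕ → ℕ → ℕ
⌈log[ b ] a ⌉ = leastExponent b a a 0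

n<b^n : ∀ {b} → 2 ≤ b → ∀ n → n < b ^ n
n<b^n         2≤b zero    = s≤s z≤n
n<b^n {b}     2≤b (suc n) = begin-strict
  suc n           ≤⟨ ih ⟩
  b ^ n           <⟨ m<m+n (b ^ n) (≤-trans (s≤s z≤n) ih) ⟩
  b ^ n + b ^ n   ≡⟨ cong (b ^ n +_) (+-identityʳ (b ^ n)) ⟨
  2 * b ^ n       ≤⟨ *-monoˡ-≤ (b ^ n) 2≤b ⟩
  b * b ^ n       ∎
  where
  open ≤-Reasoning
  ih = n<b^n 2≤b n

leastExponent-isMinimum :
  ∀ b a fuel t → a ≤ b ^ (t + fuel) → (∀ {i} → a ≤ b ^ i → t ≤ i) →
  IsMinimum (λ i → a ≤ b ^ i) (leastExponent b a fuel t)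
leastExponent-isMinimum b a zero t bound lower =
  subst (λ i → a ≤ b ^ i) (+-identityʳ t) bound , lower
leastExponent-isMinimum b a (suc fuel) t bound lower with a ≤? b ^ t
... | yes a≤ = a≤ , lower
... | no  a≰ = leastExponent-isMinimum b a fuel (suc t)
  (subst (λ i → a ≤ b ^ i) (+-suc t fuel) bound)
  (λ {i} a≤ → ≤∧≢⇒< (lower a≤) λ { refl → a≰ a≤ })

⌈log⌉-isMinimum : ∀ {b} → 2 ≤ b → ∀ a →
                  IsMinimum (λ t → a ≤ b ^ t) ⌈log[ b ] a ⌉
⌈log⌉-isMinimum {b} 2≤b a =
  leastExponent-isMinimum b a a 0 (<⇒≤ (n<b^n 2≤b a)) (λ _ → z≤n)

Tuple : ℕ → ℕ → Set
Tuple k n = Vec (Fin k) n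

Fun : ℕ → ℕ → Set
Fun k n = Tuple k n → Fin k

infix 4 _⊑_ _⊑?_ _≟ᵗ_

_⊑_ : ∀ {k n} → Tuple k n → Tuple k n → Set
_⊑_ = Pointwise Fin._≤_

_⊑?_ : ∀ {k n} → Binary.Decidable (_⊑_ {k} {n})
_⊑?_ = Pointwise.decidable Fin._≤?_

_≟ᵗ_ : ∀ {k n} → Binary.DecidableEquality (Tuple k n)
_≟ᵗ_ = Vec.≡-dec Fin._≟_

Monotone : ∀ {k n} → Fun k n → Set
Monotone f = ∀ α β → α ⊑ β → f α Fin.≤ f β

-- Chains may be empty; this does not affect the maximum below, as the empty
-- chain has decrease 0.

IsChain : ∀ {k n} → List (Tuple k n) → Set
IsChain C = Linked _⊑_ C × Unique C

isChain? : ∀ {k n} → Decidable (IsChain {k} {n})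
isChain? {k} {n} C =
  linked? _⊑?_ C ×-dec DecUnique.unique? (decSetoid (_≟ᵗ_ {k} {n})) C

Jump : ∀ {k n} → List (Fun k n) → Tuple k n → Tuple k n → Set
Jump F α β = α ⊑ β × Any (λ f → f α Fin.> f β) F

jump? : ∀ {k n} (F : List (Fun k n)) → Binary.Decidable (Jump F)
jump? F α β = α ⊑? β ×-dec any? (λ f → f β Fin.<? f α) F

chainDecrease : ∀ {k n} → List (Fun k n) → List (Tuple k n) → ℕ
chainDecrease F C =
  length (filter (λ αβ → jump? F (proj₁ αβ) (proj₂ αβ)) (zip C (drop 1 C)))

tuples : ∀ k n → List (Tuple k n)
tuples k zero    = [] ∷ []
tuples k (suc n) = cartesianProductWith _∷_ (allFin k) (tuples k n)

-- Lists of length at most ℓ, not exactly ℓ.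

lists : ∀ {A : Set} → List A → (ℓ : ℕ) → List (List A)
lists xs zero    = [] ∷ []
lists xs (suc ℓ) = [] ∷ cartesianProductWith _∷_ xs (lists xs ℓ)

-- The entries of a chain are distinct, so its length is at most the number
-- of all tuples.

chains : ∀ k n → List (List (Tuple k n))
chains k n = filter isChain? (lists (tuples k n) (length (tuples k n)))

decrease : ∀ {k n} → List (Fun k n) → ℕ
decrease {k} {n} F = chainDecrease F (argmax (chainDecrease F) [] (chains k n))

∈-tuples : ∀ {k n} (α : Tuple k n) → α ∈ tuples k n
∈-tuples []      = here refl
∈-tuples (a ∷ α) = ∈-cartesianProductWith⁺ _∷_ (∈-allFin a) (∈-tuples α)

∈-lists : ∀ {A : Set} {xs ys : List A} {ℓ} →
          All (_∈ xs) ys → length ys ≤ ℓ → ys ∈ lists xs ℓ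
∈-lists {ℓ = zero}  []         _         = here refl
∈-lists {ℓ = suc ℓ} []         _         = here refl
∈-lists {ℓ = suc ℓ} (y∈ ∷ ys∈) (s≤s len) =
  there (∈-cartesianProductWith⁺ _∷_ y∈ (∈-lists ys∈ len))

unique⇒lookup-injective : ∀ {A : Set} {xs : List A} → Unique xs →
                          ∀ {i j} → lookup xs i ≡ lookup xs j → i ≡ j
unique⇒lookup-injective (_  ∷ _) {Fin.zero}  {Fin.zero}  _  = refl
unique⇒lookup-injective {xs = _ ∷ xs} (x≢ ∷ _) {Fin.zero}  {Fin.suc j} eq =
  contradiction eq (All.lookup x≢ (∈-lookup j))
unique⇒lookup-injective {xs = _ ∷ xs} (x≢ ∷ _) {Fin.suc i} {Fin.zero}  eq =
  contradiction (sym eq) (All.lookup x≢ (∈-lookup i))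
unique⇒lookup-injective (_  ∷ u) {Fin.suc i} {Fin.suc j} eq =
  cong Fin.suc (unique⇒lookup-injective u eq)

unique⇒length≤ : ∀ {A : Set} {xs ys : List A} → Unique xs →
                 (∀ x → x ∈ ys) → length xs ≤ length ys
unique⇒length≤ {xs = xs} {ys} u complete =
  Fin.injective⇒≤ {f = λ i → Any.index (complete (lookup xs i))} λ {i} {j} eq →
    unique⇒lookup-injective u
      (trans (Any.lookup-index (complete (lookup xs i)))
        (trans (cong (lookup ys) eq)
          (sym (Any.lookup-index (complete (lookup xs j))))))

∈-chains : ∀ {k n} {C : List (Tuple k n)} → IsChain C → C ∈ chains k n
∈-chains {C = C} isChain = ∈-filter⁺ isChain?
  (∈-lists (All.universal ∈-tuples C) (unique⇒length≤ (proj₂ isChain) ∈-tuples))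
  isChain

decrease-isMaximum : ∀ {k n} (F : List (Fun k n)) →
  IsMaximum (λ m → ∃[ C ] IsChain C × chainDecrease F C ≡ m) (decrease F)
decrease-isMaximum {k} {n} F =
  (_ , argmax-all (chainDecrease F) {P = IsChain} ([] , [])
         (All.all-filter isChain? (lists (tuples k n) (length (tuples k n)))) , refl) ,
  λ { (C , isChain , refl) →
      All.lookup (f[xs]≤f[argmax] {f = chainDecrease F} [] (chains k n))
                 (∈-chains isChain) }

-- The basis M ∪ {ω₁, …, ωₚ}; only its non-monotone part is recorded.

record Basis (k : ℕ) : Set where
  field
    p           : ℕ
    1≤p         : 1 ≤ p
    arity       : Fin p → ℕ
    ω           : (i : Fin p) → Fun k (arity i)
    nonMonotone : ∀ i → ¬ Monotone (ω i)

basisDecrease : ∀ {k} → Basis k → ℕ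
basisDecrease B = max 0 (tabulate (λ i → decrease (ω i ∷ [])))
  where open Basis B

nonMonotone⇒1≤decrease : ∀ {k n} (f : Fun k n) → ¬ Monotone f →
                         1 ≤ decrease (f ∷ [])
nonMonotone⇒1≤decrease f ¬mono with 1 ≤? decrease (f ∷ [])
... | yes 1≤d = 1≤d
... | no  1≰d = contradiction mono ¬mono
  where
  mono : Monotone f
  mono α β α⊑β with f α Fin.≤? f β
  ... | yes fα≤fβ = fα≤fβ
  ... | no  fα≰fβ = contradiction
    (subst (_≤ decrease (f ∷ [])) oneJump
      (proj₂ (decrease-isMaximum (f ∷ [])) (_ , isChain , refl)))
    1≰d
    where
    isChain : IsChain (α ∷ β ∷ [])
    isChain = (α⊑β ∷ [-]) ,
      (((λ { refl → fα≰fβ Fin.≤-refl }) ∷ []) ∷ [] ∷ [])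

    oneJump : chainDecrease (f ∷ []) (α ∷ β ∷ []) ≡ 1
    oneJump = cong length
      (filter-accept (λ αβ → jump? (f ∷ []) (proj₁ αβ) (proj₂ αβ)) {xs = []}
        (α⊑β , here (≰⇒> fα≰fβ)))

-- So the base d(B) + 1 of the logarithm is at least 2.

1≤basisDecrease : ∀ {k} (B : Basis k) → 1 ≤ basisDecrease B
1≤basisDecrease B = ≤-trans
  (nonMonotone⇒1≤decrease (ω i) (nonMonotone i))
  (All.lookup (xs≤max 0 (tabulate (λ i → decrease (ω i ∷ [])))) (∈-tabulate⁺ i))
  where
  open Basis B
  i = Fin.fromℕ< 1≤p

data Gate {k} (B : Basis k) : ℕ → Set where
  mono : ∀ {q} (f : Fun k q) → Monotone f → Gate B q
  nonm : ∀ i → Gate B (Basis.arity B i)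

⟦_⟧ : ∀ {k} {B : Basis k} {q} → Gate B q → Fun k q
⟦ mono f _ ⟧         = f
⟦_⟧ {B = B} (nonm i) = Basis.ω B i

-- A node on the vertex set Fin s: either a source labelled by a variable, or
-- a gate together with the tails of its ordered incoming edges.

data Node {k} (B : Basis k) (n s : ℕ) : Set where
  input : Fin n → Node B n s
  gate  : ∀ {q} → Gate B q → (Fin q → Fin s) → Node B n s

data _Feeds_ {k} {B : Basis k} {n s} (u : Fin s) : Node B n s → Set where
  feeds : ∀ {q} {g : Gate B q} {args} (j : Fin q) → args j ≡ u →
          u Feeds gate g args

weight : ∀ {k} {B : Basis k} {n s} → Node B n s → ℕ
weight (input _)           = 0
weight (gate (mono _ _) _) = 0
weight (gate (nonm _) _)   = 1

record Circuit {k} (B : Basis k) (n : ℕ) : Set where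
  field
    size : ℕ
    node : Fin size → Node B n size

  Edge : Fin size → Fin size → Set
  Edge u v = u Feeds node v

  field
    acyclic : ∀ {v} → ¬ TransClosure Edge v v

  edge-wellFounded : WellFounded Edge
  edge-wellFounded = wellFounded⁻ Edge (Fin.spo-wellFounded record
    { isEquivalence = isEquivalence
    ; irrefl        = λ { refl → acyclic }
    ; trans         = transitive Edge
    ; <-resp-≈      = resp₂ (TransClosure Edge)
    })

  evalAcc : Tuple k n → (v : Fin size) → Acc Edge v → Fin k
  evalNode : Tuple k n → (a : Node B n size) →
             (∀ {u} → u Feeds a → Acc Edge u) → Fin k

  evalAcc x v (acc rs) = evalNode x (node v) rs

  evalNode x (input i)     rs = Vec.lookup x i
  evalNode x (gate g args) rs =
    ⟦ g ⟧ (Vec.tabulate λ j → evalAcc x (args j) (rs (feeds j refl)))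

  computed : Fin size → Fun k n
  computed v x = evalAcc x v (edge-wellFounded v)

  cost : ℕ
  cost = sum (tabulate (weight ∘ node))

Realizes : ∀ {k} {B : Basis k} {n} → Circuit B n → List (Fun k n) → Set
Realizes S F = All (λ f → ∃[ v ] computed v ≗ f) F
  where open Circuit S

-- IsComplexity B F c expresses c = I_B(F).  It is a relation because the
-- minimum is over infinitely many circuits.

IsComplexity : ∀ {k} (B : Basis k) {n} → List (Fun k n) → ℕ → Set
IsComplexity B {n} F =
  IsMinimum (λ c → ∃[ S ] Realizes {B = B} {n} S F × Circuit.cost S ≡ c)

{-# OPTIONS --safe #-}

-- Fix a chain and a non-monotone gate none of whose non-monotone ancestors
-- decreases along it.  The inputs of the gate then form a chain as well, so the
-- gate decreases at most d(B) times, and cutting the chain at these places gives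
-- at most d(B) + 1 segments on which one more gate is non-decreasing.  After all
-- c non-monotone gates there are at most (d(B) + 1) ^ c segments, on each of
-- which every node is non-decreasing, so F can only jump between two
-- consecutive segments.

module Submission where

open import Defs
open import Data.Bool.Base using (true; false)
open import Data.Fin.Base as Fin using (Fin)
import Data.Fin.Properties as Fin
open import Data.List.Base
  using (List; []; _∷_; length; filter; map; zip; drop; tabulate; allFin)
open import Data.List.Extrema.Nat using (xs≤max)
import Data.List.Membership.DecPropositional as DecMembership
open import Data.List.Membership.Propositional using (_∈_; _∉_; find)
open import Data.List.Membership.Propositional.Properties
  using (∈-allFin; ∈-filter⁺; ∈-tabulate⁺)
open import Data.List.Properties
  using (filter-reject; length-removeAt′; map-tabulate)
import Data.List.Relation.Unary.All as All
import Data.List.Relation.Unary.AllPairs as AllPairs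
open import Data.List.Relation.Unary.Any using (here; there; index; _─_)
open import Data.List.Relation.Unary.Linked as Linked
  using (Linked; []; [-]; _∷_)
open import Data.List.Relation.Unary.Linked.Properties using (Linked⇒AllPairs; map⁺)
open import Data.Nat.Base
open import Data.Nat.ListAction using (sum)
open import Data.Nat.Properties
open import Data.Product.Base using (∃-syntax; _×_; _,_; proj₁; proj₂)
open import Data.Sum.Base using (_⊎_; inj₁; inj₂; [_,_]′; map₂)
import Data.Sum.Effectful.Left as Sumₗ
open import Data.Vec.Base as Vec using ([]; _∷_)
import Data.Vec.Properties as Vec
open import Data.Vec.Relation.Binary.Pointwise.Inductive as Pointwise using ([]; _∷_)
open import Function.Base using (_∘_; id)
open import Induction.WellFounded using (Acc; acc)
open import Level using (0ℓ)
open import Relation.Binary.Core using (Rel)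
open import Relation.Binary.Definitions using (Decidable)
open import Relation.Binary.PropositionalEquality
open import Relation.Nullary

-- Counting steps along a list

module _ {A : Set} {R : Rel A 0ℓ} (R? : Decidable R) where

  -- `chainDecrease F` is definitionally `stepCount (jump? F)`; the general form also counts the
  -- drops of a single node.
  stepCount : List A → ℕ
  stepCount xs =
    length (filter (λ xy → R? (proj₁ xy) (proj₂ xy)) (zip xs (drop 1 xs)))

  stepCount-reject : ∀ {x y} zs → ¬ R x y →
                     stepCount (x ∷ y ∷ zs) ≡ stepCount (y ∷ zs)
  stepCount-reject zs ¬r =
    cong length (filter-reject (λ xy → R? (proj₁ xy) (proj₂ xy)) ¬r)

  stepCount-∷-≤ : ∀ x y zs → stepCount (x ∷ y ∷ zs) ≤ suc (stepCount (y ∷ zs))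
  stepCount-∷-≤ x y zs with does (R? x y)
  ... | true  = ≤-refl
  ... | false = n≤1+n _

  stepCount-none : ∀ {S : Rel A 0ℓ} → (∀ {x y} → S x y → ¬ R x y) →
                   ∀ {xs} → Linked S xs → stepCount xs ≡ 0
  stepCount-none S⇒¬R []  = refl
  stepCount-none S⇒¬R [-] = refl
  stepCount-none S⇒¬R {_ ∷ _ ∷ zs} (s ∷ l) =
    trans (stepCount-reject zs (S⇒¬R s)) (stepCount-none S⇒¬R l)

module _ {A B : Set} {R : Rel A 0ℓ} {T : Rel B 0ℓ}
         (R? : Decidable R) (T? : Decidable T) where

  stepCount-map-≤ : ∀ {S : Rel A 0ℓ} (f : A → B) →
    (∀ {x y} → S x y → R x y → T (f x) (f y)) →
    ∀ {xs} → Linked S xs → stepCount R? xs ≤ stepCount T? (map f xs)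
  stepCount-map-≤ f SR⇒T []  = z≤n
  stepCount-map-≤ f SR⇒T [-] = z≤n
  stepCount-map-≤ f SR⇒T {x ∷ y ∷ _} (s ∷ l) with R? x y | T? (f x) (f y)
  ... | yes r | yes _ = s≤s (stepCount-map-≤ f SR⇒T l)
  ... | yes r | no ¬t = contradiction (SR⇒T s r) ¬t
  ... | no  _ | yes _ = m≤n⇒m≤1+n (stepCount-map-≤ f SR⇒T l)
  ... | no  _ | no  _ = stepCount-map-≤ f SR⇒T l

-- Cutting a list into segments

module _ {A : Set} {R T S S′ : Rel A 0ℓ}
         (R? : Decidable R) (T? : Decidable T)
         (refine : ∀ {x y} → S x y → ¬ T x y → S′ x y)
         {N : ℕ} (segment : ∀ {xs} → Linked S′ xs → stepCount R? xs < N) where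

  -- The witness x ∷ ys is the first of the segments into which the T-steps
  -- cut x ∷ xs.

  stepCount-firstSegment : ∀ {x xs} → Linked S (x ∷ xs) →
    ∃[ ys ] Linked S′ (x ∷ ys) ×
      stepCount R? (x ∷ xs) ≤ stepCount R? (x ∷ ys) + stepCount T? (x ∷ xs) * N
  stepCount-firstSegment [-] = [] , [-] , z≤n
  stepCount-firstSegment {x} {y ∷ zs} (s ∷ l)
    with stepCount-firstSegment l | T? x y
  ... | ys , l′ , bound | yes _ = [] , [-] , (begin
    stepCount R? (x ∷ y ∷ zs)                      ≤⟨ stepCount-∷-≤ R? x y zs ⟩
    suc (stepCount R? (y ∷ zs))                    ≤⟨ s≤s bound ⟩
    suc (stepCount R? (y ∷ ys)) + stepCount T? (y ∷ zs) * N
                                                   -- The strict bound in `segment` leaves room for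
                                                   -- the cut from `x` to `y`, which may itself be
                                                   -- an `R`-step.
                                                   ≤⟨ +-monoˡ-≤ _ (segment l′) ⟩
    suc (stepCount T? (y ∷ zs)) * N                ∎)
    where open ≤-Reasoning
  ... | ys , l′ , bound | no ¬t =
    y ∷ ys , refine s ¬t ∷ l′ , step
    where
    step : stepCount R? (x ∷ y ∷ zs) ≤
           stepCount R? (x ∷ y ∷ ys) + stepCount T? (y ∷ zs) * N
    step with does (R? x y)
    ... | true  = s≤s bound
    ... | false = bound

  -- There is one segment more than there are cuts: the first segment supplies the extra `N` and the
  -- strictness.
  stepCount-segments : ∀ {xs} → Linked S xs →
                       stepCount R? xs < suc (stepCount T? xs) * N
  stepCount-segments {[]}     _ = ≤-trans (segment []) (m≤m+n N 0)
  stepCount-segments {x ∷ xs} l =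
    let ys , l′ , bound = stepCount-firstSegment l in
    ≤-trans (s≤s bound) (+-monoˡ-≤ (stepCount T? (x ∷ xs) * N) (segment l′))

-- Chains with repetitions

⊑-antisym : ∀ {k n} {α β : Tuple k n} → α ⊑ β → β ⊑ α → α ≡ β
⊑-antisym []       []       = refl
⊑-antisym (p ∷ ps) (q ∷ qs) = cong₂ _∷_ (Fin.≤-antisym p q) (⊑-antisym ps qs)

infix 4 _⊏_

_⊏_ : ∀ {k n} → Tuple k n → Tuple k n → Set
α ⊏ β = α ⊑ β × α ≢ β

⊏-trans : ∀ {k n} {α β γ : Tuple k n} → α ⊏ β → β ⊏ γ → α ⊏ γ
⊏-trans (α⊑β , α≢β) (β⊑γ , _) =
  Pointwise.trans Fin.≤-trans α⊑β β⊑γ , λ { refl → α≢β (⊑-antisym α⊑β β⊑γ) }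

⊏-linked⇒isChain : ∀ {k n} {C : List (Tuple k n)} → Linked _⊏_ C → IsChain C
⊏-linked⇒isChain l =
  Linked.map proj₁ l , AllPairs.map proj₂ (Linked⇒AllPairs ⊏-trans l)

jump⇒≢ : ∀ {k n} (F : List (Fun k n)) {α β} → Jump F α β → α ≢ β
jump⇒≢ F (_ , drops) refl = let _ , _ , fα<fα = find drops in <-irrefl refl fα<fα

-- The inputs of a gate may repeat along a chain, while `decrease` speaks of distinct tuples. Equal
-- neighbours are never a jump, so merging them costs nothing.
removeRepetitions : ∀ {k n} (F : List (Fun k n)) {α C} → Linked _⊑_ (α ∷ C) →
  ∃[ C′ ] Linked _⊏_ (α ∷ C′) × chainDecrease F (α ∷ C) ≡ chainDecrease F (α ∷ C′)
removeRepetitions F [-] = [] , [-] , refl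
removeRepetitions F {α} {β ∷ C} (α⊑β ∷ l) with removeRepetitions F l | α ≟ᵗ β
... | C′ , l′ , eq | yes refl =
  C′ , l′ , trans (stepCount-reject (jump? F) C λ j → jump⇒≢ F j refl) eq
... | C′ , l′ , eq | no α≢β = β ∷ C′ , (α⊑β , α≢β) ∷ l′ , step
  where
  step : chainDecrease F (α ∷ β ∷ C) ≡ chainDecrease F (α ∷ β ∷ C′)
  step with does (jump? F α β)
  ... | true  = cong suc eq
  ... | false = eq

chainDecrease≤decrease : ∀ {k n} (F : List (Fun k n)) {C} → Linked _⊑_ C →
                         chainDecrease F C ≤ decrease F
chainDecrease≤decrease F {[]}    _ = z≤n
chainDecrease≤decrease F {α ∷ C} l =
  let C′ , l′ , eq = removeRepetitions F l in
  subst (_≤ decrease F) (sym eq)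
    (proj₂ (decrease-isMaximum F) (_ , ⊏-linked⇒isChain l′ , refl))

decrease-ω≤basisDecrease : ∀ {k} (B : Basis k) i →
                           decrease (Basis.ω B i ∷ []) ≤ basisDecrease B
decrease-ω≤basisDecrease B i = All.lookup
  (xs≤max 0 (tabulate λ i → decrease (Basis.ω B i ∷ []))) (∈-tabulate⁺ i)

-- Auxiliary facts on lists and finite alternatives

∈-─ : ∀ {A : Set} {xs : List A} {x y} (x∈xs : x ∈ xs) → y ∈ xs →
      y ≡ x ⊎ y ∈ (xs ─ x∈xs)
∈-─ (here refl)  (here refl)  = inj₁ refl
∈-─ (here _)     (there y∈xs) = inj₂ y∈xs
∈-─ (there _)    (here refl)  = inj₂ (here refl)
∈-─ (there x∈xs) (there y∈xs) = map₂ there (∈-─ x∈xs y∈xs)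

length-filter-1≤≤sum : ∀ {A : Set} (f : A → ℕ) xs →
                       length (filter (λ x → 1 ≤? f x) xs) ≤ sum (map f xs)
length-filter-1≤≤sum f []       = z≤n
length-filter-1≤≤sum f (x ∷ xs) with f x
... | zero  = length-filter-1≤≤sum f xs
... | suc m = s≤s (m≤n⇒m≤o+n m (length-filter-1≤≤sum f xs))

⊎-sequence : ∀ {A : Set} {m} {P : Fin m → Set} →
             (∀ i → A ⊎ P i) → A ⊎ (∀ i → P i)
⊎-sequence {A} = Fin.sequence (Sumₗ.applicative A 0ℓ)

-- Values computed at the nodes

module _ {k} {B : Basis k} {n} (S : Circuit B n) where
  open Circuit S
  open DecMembership (Fin._≟_ {size}) using (_∈?_)

  private
    D = basisDecrease B

    ∀Acc : (a : Node B n size) → Set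
    ∀Acc a = ∀ {u} → u Feeds a → Acc Edge u

  evalNode-cong : ∀ x a {rs rs′ : ∀Acc a} →
    (∀ {u} (e : u Feeds a) → evalAcc x u (rs e) ≡ evalAcc x u (rs′ e)) →
    evalNode x a rs ≡ evalNode x a rs′
  evalNode-cong x (input i)     eq = refl
  evalNode-cong x (gate g args) eq =
    cong ⟦ g ⟧ (Vec.tabulate-cong λ j → eq (feeds j refl))

  -- Accessibility proofs contain functions, so instead of identifying the proofs one compares the
  -- values, by recursion along the edges.
  evalAcc-irrelevant : ∀ x v (p q : Acc Edge v) → evalAcc x v p ≡ evalAcc x v q
  evalAcc-irrelevant x v (acc rs) (acc rs′) =
    evalNode-cong x (node v) λ e → evalAcc-irrelevant x _ (rs e) (rs′ e)

  computed-unfold : ∀ x v →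
    computed v x ≡ evalNode x (node v) (λ {u} _ → edge-wellFounded u)
  computed-unfold x v with edge-wellFounded v
  ... | acc rs = evalNode-cong x (node v) λ e →
    evalAcc-irrelevant x _ (rs e) (edge-wellFounded _)

  computed-input : ∀ {v i} → node v ≡ input i → ∀ x → computed v x ≡ Vec.lookup x i
  computed-input {v} eq x =
    trans (computed-unfold x v) (helper (node v) eq)
    where
    -- With `node v` generalized to a variable, the equation can be matched with `refl`.
    helper : ∀ a {i} {rs : ∀Acc a} → a ≡ input i → evalNode x a rs ≡ Vec.lookup x i
    helper _ refl = refl

  arguments : ∀ {q} → (Fin q → Fin size) → Tuple k n → Tuple k q
  arguments args x = Vec.tabulate λ j → computed (args j) x

  computed-gate : ∀ {v q} {g : Gate B q} {args} → node v ≡ gate g args →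
                  ∀ x → computed v x ≡ ⟦ g ⟧ (arguments args x)
  computed-gate {v} eq x = trans (computed-unfold x v) (helper (node v) eq)
    where
    helper : ∀ a {q} {g : Gate B q} {args} → a ≡ gate g args →
             evalNode x a (λ {u} _ → edge-wellFounded u) ≡ ⟦ g ⟧ (arguments args x)
    helper _ refl = refl

  -- Finding the next gate to cut at

  NonDecreasing : Tuple k n → Tuple k n → Fin size → Set
  NonDecreasing α β v = computed v α Fin.≤ computed v β

  Drop : Fin size → Rel (Tuple k n) 0ℓ
  Drop v α β = computed v β Fin.< computed v α

  drop? : ∀ v → Decidable (Drop v)
  drop? v α β = computed v β Fin.<? computed v α

  -- U lists the non-monotone gates that are still allowed to decrease.

  Step : List (Fin size) → Rel (Tuple k n) 0ℓ
  Step U α β = α ⊑ β ×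
    (∀ v → 1 ≤ weight (node v) → v ∉ U → NonDecreasing α β v)

  AlwaysNonDecreasing : List (Fin size) → Fin size → Set
  AlwaysNonDecreasing U v = ∀ {α β} → Step U α β → NonDecreasing α β v

  -- The gate to be removed from `U` next: its inputs grow along every `Step U` chain, so the
  -- decrease of its `ω` bounds its drops.
  record Ready (U : List (Fin size)) : Set where
    constructor ready
    field
      {v}    : Fin size
      v∈U    : v ∈ U
      {i}    : Fin (Basis.p B)
      {args} : Fin (Basis.arity B i) → Fin size
      isω    : node v ≡ gate (nonm i) args
      argumentsNonDecreasing : ∀ j → AlwaysNonDecreasing U (args j)

  -- Recursion along the edges. If no ready gate turns up below `v`, all its inputs are
  -- non-decreasing; then a monotone gate is too, a non-monotone gate outside `U` is so by `Step`,
  -- and one in `U` is itself ready.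
  search : ∀ U v → Acc Edge v → Ready U ⊎ AlwaysNonDecreasing U v
  search U v (acc rs) = atNode (node v) refl λ e → search U _ (rs e)
    where
    atNode : ∀ a → node v ≡ a →
             (∀ {u} → u Feeds node v → Ready U ⊎ AlwaysNonDecreasing U u) →
             Ready U ⊎ AlwaysNonDecreasing U v
    atNode (input i) eq _ = inj₂ λ {α} {β} (α⊑β , _) →
      subst₂ Fin._≤_ (sym (computed-input eq α)) (sym (computed-input eq β))
        (Pointwise.lookup α⊑β i)
    atNode (gate g args) eq ih =
      [ inj₁ , atGate g eq ]′
        (⊎-sequence λ j → ih (subst (args j Feeds_) (sym eq) (feeds j refl)))
      where
      atGate : ∀ {q} (g : Gate B q) {args} → node v ≡ gate g args →
               (∀ j → AlwaysNonDecreasing U (args j)) →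
               Ready U ⊎ AlwaysNonDecreasing U v
      atGate (mono f f-mono) eq nd = inj₂ λ {α} {β} s →
        subst₂ Fin._≤_ (sym (computed-gate eq α)) (sym (computed-gate eq β))
          (f-mono _ _ (Pointwise.tabulate⁺ λ j → nd j s))
      atGate (nonm i) eq nd with v ∈? U
      ... | yes v∈U = inj₁ (ready v∈U eq nd)
      ... | no  v∉U = inj₂ λ s →
        proj₂ s v (≤-reflexive (sym (cong weight eq))) v∉U

  ready-drops≤ : ∀ {U} (r : Ready U) {C} → Linked (Step U) C →
                 stepCount (drop? (Ready.v r)) C ≤ D
  ready-drops≤ {U} (ready {v} v∈U {i} {args} isω nd) {C} l = begin
    stepCount (drop? v) C
      ≤⟨ stepCount-map-≤ (drop? v) (jump? (ω ∷ [])) (arguments args) drop⇒jump l ⟩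
    chainDecrease (ω ∷ []) (map (arguments args) C)
      ≤⟨ chainDecrease≤decrease (ω ∷ []) (map⁺ (Linked.map arguments-⊑ l)) ⟩
    decrease (ω ∷ [])
      ≤⟨ decrease-ω≤basisDecrease B i ⟩
    D ∎
    where
    open ≤-Reasoning
    ω = Basis.ω B i

    arguments-⊑ : ∀ {α β} → Step U α β → arguments args α ⊑ arguments args β
    arguments-⊑ s = Pointwise.tabulate⁺ λ j → nd j s

    drop⇒jump : ∀ {α β} → Step U α β → Drop v α β →
                Jump (ω ∷ []) (arguments args α) (arguments args β)
    drop⇒jump {α} {β} s d = arguments-⊑ s ,
      here (subst₂ Fin._<_ (computed-gate isω β) (computed-gate isω α) d)

  -- Only `v` can belong to `U` but not to the shortened list, and its new condition is the absence
  -- of a drop.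
  step-─ : ∀ {U v} (v∈U : v ∈ U) {α β} →
           Step U α β → ¬ Drop v α β → Step (U ─ v∈U) α β
  step-─ {U} {v} v∈U {α} {β} (α⊑β , nd) ¬d = α⊑β , λ u 1≤w u∉ → case u 1≤w u∉
    where
    case : ∀ u → 1 ≤ weight (node u) → u ∉ (U ─ v∈U) → NonDecreasing α β u
    case u 1≤w u∉ with u ∈? U
    ... | no u∉U = nd u 1≤w u∉U
    ... | yes u∈U with ∈-─ v∈U u∈U
    ...   | inj₁ refl = ≮⇒≥ ¬d
    ...   | inj₂ u∈   = contradiction u∈ u∉

  -- Bounding the jumps of the system

  module _ {F : List (Fun k n)} (realizes : Realizes S F) where

    nonDecreasing⇒¬jump : ∀ {α β} → (∀ v → NonDecreasing α β v) → ¬ Jump F α β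
    nonDecreasing⇒¬jump {α} {β} nd (_ , drops) =
      let f , f∈F , fβ<fα = find drops
          v , v≗f         = All.lookup realizes f∈F
      in <⇒≱ fβ<fα (subst₂ Fin._≤_ (v≗f α) (v≗f β) (nd v))

    -- Induction on the length of `U`. Without a ready gate no node decreases and there is no jump.
    -- Otherwise the drops of a ready gate cut the chain into at most `D + 1` segments, and the
    -- induction hypothesis applies to each with that gate removed.
    jumps<power : ∀ m U → length U ≡ m → ∀ {C} → Linked (Step U) C →
                  chainDecrease F C < (D + 1) ^ m
    jumps<power m U len {C} l with ⊎-sequence (λ v → search U v (edge-wellFounded v))
    ... | inj₂ nd = subst (_< (D + 1) ^ m)
      (sym (stepCount-none (jump? F) (λ s → nonDecreasing⇒¬jump λ v → nd v s) l))
      (m^n>0 (D + 1) {{>-nonZero (m≤n+m 1 D)}} m)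
    jumps<power zero    [] len l | inj₁ (ready () _ _)
    jumps<power (suc m) U  len {C} l | inj₁ r@(ready {v} v∈U _ _) = begin-strict
      chainDecrease F C
        <⟨ stepCount-segments (jump? F) (drop? v) (step-─ v∈U)
             (jumps<power m (U ─ v∈U) len′) l ⟩
      suc (stepCount (drop? v) C) * (D + 1) ^ m
        ≤⟨ *-monoˡ-≤ ((D + 1) ^ m) (s≤s (ready-drops≤ r l)) ⟩
      suc D * (D + 1) ^ m
        ≡⟨ cong (_* (D + 1) ^ m) (+-comm 1 D) ⟩
      (D + 1) ^ suc m ∎
      where
      open ≤-Reasoning
      len′ = suc-injective (trans (sym (length-removeAt′ U (index v∈U))) len)

    decrease<power-cost : decrease F < (D + 1) ^ cost
    decrease<power-cost =
      let (C , (linked , _) , eq) , _ = decrease-isMaximum F in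
      ≤-trans
        (subst (_< (D + 1) ^ length U) eq
          (jumps<power (length U) U refl (Linked.map ⊑⇒step linked)))
        (^-monoʳ-≤ (D + 1) {{>-nonZero (m≤n+m 1 D)}} length≤cost)
      where
      w = weight ∘ node
      U = filter (λ v → 1 ≤? w v) (allFin size)

      -- `U` initially holds every gate of positive weight, so the second condition of `Step U` is
      -- vacuous.
      ⊑⇒step : ∀ {α β} → α ⊑ β → Step U α β
      ⊑⇒step α⊑β = α⊑β , λ v 1≤w v∉U →
        contradiction (∈-filter⁺ (λ v → 1 ≤? w v) (∈-allFin v) 1≤w) v∉U

      length≤cost : length U ≤ cost
      length≤cost = subst (length U ≤_) (cong sum (map-tabulate id w))
        (length-filter-1≤≤sum w (allFin size))

theorem1 : (k : ℕ) → 2 ≤ k → (B : Basis k) (n : ℕ) (F : List (Fun k n)) (c : ℕ) →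
    IsComplexity B F c → c ≥ ⌈log[ basisDecrease B + 1 ] decrease F + 1 ⌉
theorem1 k _ B n F c ((S , realizes , refl) , _) =
  -- The logarithm is the least exponent whose power reaches `decrease F + 1`, and `c` is such an
  -- exponent.
  proj₂ (⌈log⌉-isMinimum (+-monoˡ-≤ 1 (1≤basisDecrease B)) (decrease F + 1))
    (subst (_≤ (basisDecrease B + 1) ^ c) (+-comm 1 (decrease F))
      (decrease<power-cost S realizes))
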